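{- Let $L_1$ and $L_2$ be two distinct rooted trees with $\ell$ vertices, and let $\ell_{1,n}$ and $\ell_{2,n}$ denote the number of $n$-vertex rooted trees without $L_1$, respectively without $L_2$, as a maximal limb. Then $\ell_{1,n}=\ell_{2,n}$.
   Context: Rooted trees are finite and are counted up to root-preserving isomorphism. For a rooted tree $T$ and a vertex $v$ of $T$, the maximal limb at $v$ is the rooted subtree of $T$ with root $v$ consisting of $v$ and all descendants of $v$. The tree $T$ has $L$ as a maximal limb if for some vertex $v$ of $T$ the maximal limb at $v$ is isomorphic to $L$ as a rooted tree. -}

module Defs where

open import Data.Fin using (Fin)
import Data.Fin.Permutation as Perm
open import Data.List using (List; length; lookup)
open import Data.Nat using (ℕ)
open import Data.Product using (∃-syntax; _×_; proj₁)
open import Data.Sum using (_⊎_)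
open import Function.Bundles using (Inverse; _↔_; _⇔_; Equivalence; mk⇔)
import Function.Construct.Composition as Composition
import Function.Construct.Symmetry as Symmetry
open import Function.Properties.Inverse using (↔-refl; ↔-sym; ↔-trans)
open import Level using (Level; 0ℓ)
open import Relation.Binary.Bundles using (Setoid)
import Relation.Binary.Construct.On as On
open import Relation.Binary.PropositionalEquality as ≡
  using (_≡_; refl; cong; trans; subst₂)
open import Relation.Nullary using (¬_)

private
  variable
    a r : Level

-- A setoid has cardinality k when its set of equivalence classes is in
-- bijection with Fin k.
HasCardinality : Setoid a r → ℕ → Set _
HasCardinality S k = Inverse S (≡.setoid (Fin k))

cardinality-unique : (S : Setoid a r) {j k : ℕ} →
                     HasCardinality S j → HasCardinality S k → j ≡ k
cardinality-unique S p q =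
  Perm.↔⇒≡ (Composition.inverse (Symmetry.inverse p) q)

-- The order of the children list carries no meaning: trees are only ever
-- compared through _≅_ below, never through _≡_.
data RootedTree : Set where
  node : List RootedTree → RootedTree

data Vertex : RootedTree → Set where
  root  : ∀ {ts} → Vertex (node ts)
  child : ∀ {ts} (i : Fin (length ts)) → Vertex (lookup ts i) → Vertex (node ts)

rootOf : ∀ T → Vertex T
rootOf (node ts) = root

-- v ⊳ w : v is the parent of w.
data _⊳_ : ∀ {T} → Vertex T → Vertex T → Set where
  top    : ∀ {ts} (i : Fin (length ts)) →
           root {ts} ⊳ child i (rootOf (lookup ts i))
  within : ∀ {ts} (i : Fin (length ts)) {v w : Vertex (lookup ts i)} →
           v ⊳ w → child {ts} i v ⊳ child i w

Adjacent : ∀ {T} → Vertex T → Vertex T → Set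
Adjacent v w = v ⊳ w ⊎ w ⊳ v

-- Root-preserving graph isomorphism.
infix 4 _≅_
record _≅_ (S T : RootedTree) : Set where
  field
    vertices : Vertex S ↔ Vertex T
  open Inverse vertices public using (to; from)
  field
    preserves-root     : to (rootOf S) ≡ rootOf T
    preserves-adjacent : ∀ v w → Adjacent v w ⇔ Adjacent (to v) (to w)

≅-refl : ∀ {T} → T ≅ T
≅-refl = record
  { vertices           = ↔-refl
  ; preserves-root     = refl
  ; preserves-adjacent = λ _ _ → mk⇔ (λ e → e) (λ e → e)
  }

≅-sym : ∀ {S T} → S ≅ T → T ≅ S
≅-sym f = record
  { vertices           = ↔-sym vertices
  ; preserves-root     = inverseʳ (≡.sym preserves-root)
  ; preserves-adjacent = λ v w →
      let module A = Equivalence (preserves-adjacent (from v) (from w))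
          v≡ = inverseˡ {v} refl
          w≡ = inverseˡ {w} refl
      in mk⇔ (λ e → A.from (subst₂ Adjacent (≡.sym v≡) (≡.sym w≡) e))
             (λ e → subst₂ Adjacent v≡ w≡ (A.to e))
  }
  where
  open _≅_ f
  open Inverse vertices using (inverseˡ; inverseʳ)

≅-trans : ∀ {S T U} → S ≅ T → T ≅ U → S ≅ U
≅-trans f g = record
  { vertices           = ↔-trans F.vertices G.vertices
  ; preserves-root     = trans (cong G.to F.preserves-root) G.preserves-root
  ; preserves-adjacent = λ v w →
      let module A = Equivalence (F.preserves-adjacent v w)
          module B = Equivalence (G.preserves-adjacent (F.to v) (F.to w))
      in mk⇔ (λ e → B.to (A.to e)) (λ e → A.from (B.from e))
  }
  where
  module F = _≅_ f
  module G = _≅_ g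

rootedTreeSetoid : Setoid 0ℓ 0ℓ
rootedTreeSetoid = record
  { Carrier       = RootedTree
  ; _≈_           = _≅_
  ; isEquivalence = record { refl = ≅-refl ; sym = ≅-sym ; trans = ≅-trans }
  }

HasVertices : RootedTree → ℕ → Set
HasVertices T n = HasCardinality (≡.setoid (Vertex T)) n

maximalLimb : (T : RootedTree) → Vertex T → RootedTree
maximalLimb T         root        = T
maximalLimb (node ts) (child i v) = maximalLimb (lookup ts i) v

HasMaximalLimb : RootedTree → RootedTree → Set
HasMaximalLimb T L = ∃[ v ] maximalLimb T v ≅ L

-- The n-vertex rooted trees without L as a maximal limb, identified up to _≅_.
TreesWithout : RootedTree → ℕ → Setoid 0ℓ 0ℓ
TreesWithout L n = On.setoid rootedTreeSetoid
  (proj₁ {B = λ T → HasVertices T n × ¬ HasMaximalLimb T L})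

{-# OPTIONS --safe #-}

-- Exchange the two limbs: replace every maximal limb L₁ by L₂ and every
-- maximal limb L₂ by L₁.  As L₁ and L₂ have the same size, neither is a proper
-- limb of the other, and vertices above a replaced limb have limbs that are
-- too big to be L₁ or L₂, before or after.  So the exchange is a size-preserving
-- involution on isomorphism classes that turns limbs L₁ into limbs L₂ and back.
--
-- To count constructively, isomorphism is decided through matchings of
-- children: two trees are isomorphic exactly when some bijection pairs the
-- children of their roots with isomorphic ones.

module Submission where

open import Defs
open import Data.Empty using (⊥)
open import Data.Fin using (Fin; zero; suc; punchIn; cast)
open import Data.Fin.Permutation as Perm using (Permutation; _⟨$⟩ʳ_; _∘ₚ_)
open import Data.Fin.Properties using (+↔⊎; 1↔⊤; any?; cast-involutive)
open import Data.List using
  (List; []; _∷_; [_]; length; lookup; map; filter; deduplicate;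
   cartesianProductWith)
open import Data.List.Membership.Propositional using (_∈_; find; lose)
open import Data.List.Membership.Propositional.Properties using
  (∈-lookup; ∈-filter⁺; ∈-map⁺; ∈-cartesianProductWith⁺)
import Data.List.Membership.Setoid as SetoidMembership
open import Data.List.Membership.Setoid.Properties using (∈-deduplicate⁺)
open import Data.List.Properties using (length-map; map-id; map-id-local; map-∘)
open import Data.List.Relation.Unary.All as All using (All)
open import Data.List.Relation.Unary.All.Properties using
  (all-filter; deduplicate⁺)
open import Data.List.Relation.Unary.AllPairs using (_∷_)
open import Data.List.Relation.Unary.Any as Any using (Any; here; there)
open import Data.List.Relation.Unary.Any.Properties using (map⁻; lookup-index)
import Data.List.Relation.Unary.Unique.DecSetoid.Properties as DecUnique
import Data.List.Relation.Unary.Unique.Setoid as SetoidUnique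
open import Data.Nat using (ℕ; zero; suc; _+_; _≤_; _<_; s≤s)
open import Data.Nat.Properties using
  (_≟_; ≤-trans; ≤-reflexive; <-irrefl; <⇒≤; m≤m+n; m≤n+m;
   m+n≤o⇒m≤o; m+n≤o⇒n≤o)
open import Data.Product using (Σ; ∃-syntax; _×_; _,_; proj₁; proj₂)
open import Data.Product.Function.Dependent.Propositional using (Σ-↔)
open import Data.Sum using (_⊎_; inj₁; inj₂; [_,_]′)
open import Data.Sum.Function.Propositional using (_⊎-↔_)
open import Data.Unit using (⊤; tt)
open import Function using (_∘_; id; case_of_)
open import Function.Bundles using
  (Inverse; _↔_; mk↔ₛ′; mk⇔; Equivalence)
import Function.Construct.Composition as Composition
open import Function.Properties.Inverse using (↔-refl; ↔-sym; ↔-trans)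
open import Level using (Level)
open import Relation.Binary.Bundles using (Setoid; DecSetoid)
import Relation.Binary.Construct.On as On
open import Relation.Binary.PropositionalEquality as ≡
  using (_≡_; refl; cong; cong₂; sym; trans; subst; subst₂)
open import Relation.Nullary using (¬_; Dec; yes; no; contradiction)
open import Relation.Nullary.Decidable using (map′; _×-dec_; _⊎-dec_; ¬?)
open import Relation.Unary using (Pred; Decidable)

private
  variable
    a r p : Level
    n : ℕ
    S T L : RootedTree
    ss ts : List RootedTree

-- The induction hypothesis is indexed by membership, the form in which facts about `map` over the
-- children consume it.
tree-induction : (P : RootedTree → Set p) →
                 (∀ ts → (∀ {t} → t ∈ ts → P t) → P (node ts)) → ∀ T → P T
tree-induction P step (node ts) = step ts (children ts)
  where
  children : ∀ ts {t} → t ∈ ts → P t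
  children (t ∷ ts) (here refl)  = tree-induction P step t
  children (t ∷ ts) (there t∈ts) = children ts t∈ts

-- Parents

⊳rootOf : {v : Vertex T} → ¬ v ⊳ rootOf T
⊳rootOf {node _} ()

-- ⊳ cannot be inverted by matching when its indices involve rootOf; the
-- following computes its premises from the two vertices.
ParentView : Vertex T → Vertex T → Set
ParentView {node ts} v           root        = ⊥
ParentView {node ts} root        (child j w) = w ≡ rootOf (lookup ts j)
ParentView {node ts} (child i v) (child j w) =
  ∃[ w′ ] child {ts} j w ≡ child i w′ × v ⊳ w′

parentView : {v w : Vertex T} → v ⊳ w → ParentView v w
parentView (top i)                = refl
parentView (within i {w = w} v⊳w) = w , refl , v⊳w

child-injective : ∀ {i} {v w : Vertex (lookup ts i)} →
                  child {ts} i v ≡ child i w → v ≡ w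
child-injective refl = refl

child-index : ∀ {i j} {v : Vertex (lookup ts i)} {w : Vertex (lookup ts j)} →
              child {ts} i v ≡ child j w → i ≡ j
child-index refl = refl

within⁻ : ∀ {i} {v w : Vertex (lookup ts i)} → child {ts} i v ⊳ child i w → v ⊳ w
within⁻ e with parentView e
... | _ , refl , v⊳w = v⊳w

⊳-child : ∀ {j} {v : Vertex (lookup ts j)} {x : Vertex (node ts)} →
          child j v ⊳ x → ∃[ w ] x ≡ child j w
⊳-child {x = root}      ()
⊳-child {x = child _ _} e with parentView e
... | w , eq , _ = w , eq

root-⊳ : {x : Vertex (node ts)} → root ⊳ x →
         ∃[ j ] x ≡ child j (rootOf (lookup ts j))
root-⊳ (top j) = j , refl

-- In the mixed cases `w` would be the root of a limb and still have a parent inside that limb.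
parent-unique : {u v w : Vertex T} → u ⊳ w → v ⊳ w → u ≡ v
parent-unique {u = root}      {root}      {child _ _} _  _  = refl
parent-unique {u = root}      {child _ _} {child _ _} e₁ e₂
  with parentView e₁ | parentView e₂
... | refl | _ , refl , e = contradiction e ⊳rootOf
parent-unique {u = child _ _} {root}      {child _ _} e₁ e₂
  with parentView e₁ | parentView e₂
... | _ , refl , e | refl = contradiction e ⊳rootOf
parent-unique {u = child _ _} {child i _} {child _ _} e₁ e₂
  with parentView e₁ | parentView e₂
... | _ , refl , e₁′ | _ , refl , e₂′ = cong (child i) (parent-unique e₁′ e₂′)

vertex-induction : (Q : Vertex T → Set p) → Q (rootOf T) →
                   (∀ {v w} → v ⊳ w → Q v → Q w) → ∀ v → Q v
vertex-induction Q base step root        = base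
vertex-induction Q base step (child i v) =
  vertex-induction (Q ∘ child i) (step (top i) base) (step ∘ within i) v

parent : (w : Vertex T) → w ≡ rootOf T ⊎ ∃[ v ] v ⊳ w
parent root        = inj₁ refl
parent (child i v) with parent v
... | inj₁ refl    = inj₂ (_ , top i)
... | inj₂ (_ , e) = inj₂ (_ , within i e)

⊳-asym : {v w : Vertex T} → v ⊳ w → ¬ w ⊳ v
⊳-asym {v = child _ _} {child _ _} e₁ e₂ with parentView e₁
... | _ , refl , e₁′ = ⊳-asym e₁′ (within⁻ e₂)

-- Isomorphisms as parent-preserving bijections

↔-injective : {A B : Set} (f : A ↔ B) (let open Inverse f) →
              ∀ {x y} → to x ≡ to y → x ≡ y
↔-injective f eq = trans (sym (inverseʳ refl)) (inverseʳ eq)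
  where open Inverse f

-- Parents are unique, so a bijection that preserves them also reflects them.
mk≅ : (f : Vertex S ↔ Vertex T) (let open Inverse f) → to (rootOf S) ≡ rootOf T →
      (∀ {v w} → v ⊳ w → to v ⊳ to w) → S ≅ T
mk≅ {S} f to-root to-⊳ = record
  { vertices           = f
  ; preserves-root     = to-root
  ; preserves-adjacent = λ _ _ → mk⇔
      [ inj₁ ∘ to-⊳ , inj₂ ∘ to-⊳ ]′ [ inj₁ ∘ from-⊳ , inj₂ ∘ from-⊳ ]′
  }
  where
  open Inverse f
  from-⊳ : ∀ {v w} → to v ⊳ to w → v ⊳ w
  from-⊳ {v} {w} e with parent w
  ... | inj₁ refl     = contradiction (subst (to v ⊳_) to-root e) ⊳rootOf
  ... | inj₂ (u , u⊳w) =
    subst (_⊳ w) (↔-injective f (parent-unique (to-⊳ u⊳w) e)) u⊳w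

-- Adjacency carries no direction, so the orientation is propagated from the root downwards. If an
-- edge below `v` were reversed, the image of `v` would have both its parent's image and its child's
-- image as parents; these would coincide, against `⊳-asym`.
≅-⊳ : (f : S ≅ T) (let open _≅_ f) → ∀ {v w} → v ⊳ w → to v ⊳ to w
≅-⊳ {S} f {v} = vertex-induction
  (λ v → ∀ {w} → v ⊳ w → to v ⊳ to w) base step v
  where
  open _≅_ f
  orient : ∀ {v w} → v ⊳ w → ¬ to w ⊳ to v → to v ⊳ to w
  orient {v} {w} v⊳w not-back =
    [ id , (λ e → contradiction e not-back) ]′
      (Equivalence.to (preserves-adjacent v w) (inj₁ v⊳w))
  base : ∀ {w} → rootOf S ⊳ w → to (rootOf S) ⊳ to w
  base {w} e = orient e (λ back → ⊳rootOf (subst (to w ⊳_) preserves-root back))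
  step : ∀ {u v} → u ⊳ v → (∀ {w} → u ⊳ w → to u ⊳ to w) →
         ∀ {w} → v ⊳ w → to v ⊳ to w
  step u⊳v ih v⊳w = orient v⊳w λ back →
    ⊳-asym u⊳v (subst (_ ⊳_) (↔-injective vertices (parent-unique back (ih u⊳v))) v⊳w)

-- Isomorphisms as matchings of the children of the roots

vertex↔ : Vertex (node ts) ↔ (⊤ ⊎ Σ (Fin (length ts)) (Vertex ∘ lookup ts))
vertex↔ = mk↔ₛ′
  (λ { root → inj₁ tt ; (child i v) → inj₂ (i , v) })
  (λ { (inj₁ _) → root ; (inj₂ (i , v)) → child i v })
  (λ { (inj₁ _) → refl ; (inj₂ _) → refl })
  (λ { root → refl ; (child _ _) → refl })

node-cong : (π : Permutation (length ss) (length ts)) →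
            (∀ i → lookup ss i ≅ lookup ts (π ⟨$⟩ʳ i)) → node ss ≅ node ts
node-cong {ss} {ts} π φ = mk≅ f refl f-⊳
  where
  f : Vertex (node ss) ↔ Vertex (node ts)
  f = ↔-trans vertex↔ (↔-trans
        (↔-refl ⊎-↔ Σ-↔ π (λ {i} → _≅_.vertices (φ i))) (↔-sym vertex↔))
  open Inverse f
  f-⊳ : ∀ {v w} → v ⊳ w → to v ⊳ to w
  f-⊳ (top i) = subst (λ w → root ⊳ child (π ⟨$⟩ʳ i) w)
                  (sym (_≅_.preserves-root (φ i))) (top (π ⟨$⟩ʳ i))
  f-⊳ (within i e) = within (π ⟨$⟩ʳ i) (≅-⊳ (φ i) e)

-- The image of a child of the root is again a child of the root, which determines `j`. Descending
-- edges go to descending edges, and these never leave the limb in which they start, so all of limb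
-- `i` lands in limb `j`.
≅-limb : (f : node ss ≅ node ts) (let open _≅_ f) → ∀ i →
         ∃[ j ] to (child i (rootOf (lookup ss i))) ≡ child j (rootOf (lookup ts j)) ×
                (∀ v → ∃[ w ] to (child i v) ≡ child j w)
≅-limb {ss} {ts} f i
  with root-⊳ (subst (_⊳ to (child i _)) preserves-root (≅-⊳ f (top i)))
  where open _≅_ f
... | j , eq = j , eq , vertex-induction InLimb (_ , eq)
      λ { {w = w} v⊳w (_ , eq′) →
          ⊳-child (subst (_⊳ to (child i w)) eq′ (≅-⊳ f (within i v⊳w))) }
  where
  open _≅_ f
  InLimb : Vertex (lookup ss i) → Set
  InLimb v = ∃[ w ] to (child i v) ≡ child j w

module _ {ss ts : List RootedTree} (f : node ss ≅ node ts) where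
  private
    g : node ts ≅ node ss
    g = ≅-sym f
    module F = _≅_ f
    module G = _≅_ g

    image : Fin (length ss) → Fin (length ts)
    image i = proj₁ (≅-limb f i)

    preimage : Fin (length ts) → Fin (length ss)
    preimage j = proj₁ (≅-limb g j)

    from-to : ∀ x → F.from (F.to x) ≡ x
    from-to x = Inverse.inverseʳ F.vertices refl

    to-from : ∀ y → F.to (F.from y) ≡ y
    to-from y = Inverse.inverseˡ F.vertices refl

    -- The root of limb `i` travels to the root of limb `image i` and back to that of limb
    -- `preimage (image i)`. The round trip fixes vertices, so the indices agree.
    preimage-image : ∀ i → preimage (image i) ≡ i
    preimage-image i = sym (child-index
      (trans (sym (from-to (child i (rootOf (lookup ss i)))))
        (trans (cong F.from (proj₁ (proj₂ (≅-limb f i))))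
          (proj₁ (proj₂ (≅-limb g (image i)))))))

    image-preimage : ∀ j → image (preimage j) ≡ j
    image-preimage j = sym (child-index
      (trans (sym (to-from (child j (rootOf (lookup ts j)))))
        (trans (cong F.to (proj₁ (proj₂ (≅-limb g j))))
          (proj₁ (proj₂ (≅-limb f (preimage j)))))))

  children-permutation : Permutation (length ss) (length ts)
  children-permutation =
    Perm.permutation image preimage image-preimage preimage-image

  children-≅ : ∀ i → lookup ss i ≅ lookup ts (children-permutation ⟨$⟩ʳ i)
  children-≅ i = mk≅ (mk↔ₛ′ down up down-up up-down)
    (child-injective (trans (sym (down-eq _)) (proj₁ (proj₂ (≅-limb f i)))))
    (λ {v} {w} e → within⁻ (subst₂ _⊳_ (down-eq v) (down-eq w) (≅-⊳ f (within i e))))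
    where
    down : Vertex (lookup ss i) → Vertex (lookup ts (image i))
    down v = proj₁ (proj₂ (proj₂ (≅-limb f i)) v)

    down-eq : ∀ v → F.to (child i v) ≡ child (image i) (down v)
    down-eq v = proj₂ (proj₂ (proj₂ (≅-limb f i)) v)

    -- The inverse lands in limb `preimage (image i)`, which is limb `i` only up to
    -- `preimage-image`. Transporting the whole existential moves the vertex together with its
    -- equation.
    up-∃ : ∀ w → ∃[ v ] F.from (child (image i) w) ≡ child i v
    up-∃ w = subst (λ k → ∃[ v ] F.from (child (image i) w) ≡ child k v)
               (preimage-image i) (proj₂ (proj₂ (≅-limb g (image i))) w)

    up : Vertex (lookup ts (image i)) → Vertex (lookup ss i)
    up w = proj₁ (up-∃ w)

    down-up : ∀ w → down (up w) ≡ w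
    down-up w = child-injective (trans (sym (down-eq (up w)))
      (trans (cong F.to (sym (proj₂ (up-∃ w)))) (to-from _)))

    up-down : ∀ v → up (down v) ≡ v
    up-down v = child-injective (trans (sym (proj₂ (up-∃ (down v))))
      (trans (cong F.from (sym (down-eq v))) (from-to _)))

lookup-map : ∀ {A B : Set} (f : A → B) xs i →
             lookup (map f xs) i ≡ f (lookup xs (cast (length-map f xs) i))
lookup-map f (x ∷ xs) zero    = refl
lookup-map f (x ∷ xs) (suc i) = lookup-map f xs i

-- `map` preserves length only propositionally, so `π` is framed by two casts.
map-node-cong : (f g : RootedTree → RootedTree)
  (π : Permutation (length ss) (length ts)) →
  (∀ i → f (lookup ss i) ≅ g (lookup ts (π ⟨$⟩ʳ i))) →
  node (map f ss) ≅ node (map g ts)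
map-node-cong {ss} {ts} f g π φ = node-cong
  (Perm.cast-id (length-map f ss) ∘ₚ π ∘ₚ Perm.cast-id (sym (length-map g ts)))
  λ i → subst₂ _≅_ (sym (lookup-map f ss i))
    (sym (trans (lookup-map g ts _)
      (cong (g ∘ lookup ts) (cast-involutive (length-map g ts) (sym (length-map g ts)) _))))
    (φ (cast (length-map f ss) i))

map-node-cong′ : (f g : RootedTree → RootedTree) →
  (∀ {t} → t ∈ ts → f t ≅ g t) → node (map f ts) ≅ node (map g ts)
map-node-cong′ f g f≅g = map-node-cong f g Perm.id (f≅g ∘ ∈-lookup)

-- Deciding isomorphism

infix 4 _≅?_

mutual
  Iso : RootedTree → RootedTree → Set
  Iso (node ss) (node ts) = Matches ss (lookup ts)

  -- The second family is a function on `Fin n`, so that deleting the child `j` is precomposition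
  -- with `punchIn j`. The recursion is structural in the first family.
  Matches : List RootedTree → (Fin n → RootedTree) → Set
  Matches {zero}  []       g = ⊤
  Matches {suc n} []       g = ⊥
  Matches {zero}  (s ∷ ss) g = ⊥
  Matches {suc n} (s ∷ ss) g = ∃[ j ] Iso s (g j) × Matches ss (g ∘ punchIn j)

mutual
  iso? : ∀ S T → Dec (Iso S T)
  iso? (node ss) (node ts) = matches? ss (lookup ts)

  matches? : ∀ ss (g : Fin n → RootedTree) → Dec (Matches ss g)
  matches? {zero}  []       g = yes tt
  matches? {suc n} []       g = no λ ()
  matches? {zero}  (s ∷ ss) g = no λ ()
  matches? {suc n} (s ∷ ss) g =
    any? λ j → iso? s (g j) ×-dec matches? ss (g ∘ punchIn j)

mutual
  iso⇒≅ : ∀ S T → Iso S T → S ≅ T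
  iso⇒≅ (node ss) (node ts) m with matches⇒≅ ss (lookup ts) m
  ... | π , φ = node-cong π φ

  matches⇒≅ : ∀ ss (g : Fin n → RootedTree) → Matches ss g →
              ∃[ π ] ∀ i → lookup ss i ≅ g (π ⟨$⟩ʳ i)
  matches⇒≅ {zero}  []       g _ = Perm.id , λ ()
  matches⇒≅ {suc n} (s ∷ ss) g (j , s~ , m)
    with iso⇒≅ s (g j) s~ | matches⇒≅ ss (g ∘ punchIn j) m
  ... | e | π , φ = Perm.insert zero j π , λ where
    zero    → e
    (suc i) → subst (λ k → lookup ss i ≅ g k)
                (sym (Perm.insert-punchIn zero j π i)) (φ i)

mutual
  ≅⇒iso : ∀ S T → S ≅ T → Iso S T
  ≅⇒iso (node ss) (node ts) f =
    ≅⇒matches ss (lookup ts) (children-permutation f) (children-≅ f)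

  -- The first child is paired with the image of `zero`; removing this pair from `π` leaves a
  -- permutation that `punchIn` carries to the remaining values of `π`.
  ≅⇒matches : ∀ ss (g : Fin n → RootedTree) (π : Permutation (length ss) n) →
              (∀ i → lookup ss i ≅ g (π ⟨$⟩ʳ i)) → Matches ss g
  ≅⇒matches {zero}  []       g π φ = tt
  ≅⇒matches {suc n} []       g π φ with () ← Inverse.from π zero
  ≅⇒matches {zero}  (s ∷ ss) g π φ with () ← π ⟨$⟩ʳ zero
  ≅⇒matches {suc n} (s ∷ ss) g π φ =
    π ⟨$⟩ʳ zero , ≅⇒iso s _ (φ zero) ,
    ≅⇒matches ss _ (Perm.remove zero π) λ i →
      subst (λ k → lookup ss i ≅ g k) (Perm.punchIn-permute π zero i) (φ (suc i))

_≅?_ : ∀ S T → Dec (S ≅ T)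
S ≅? T = map′ (iso⇒≅ S T) (≅⇒iso S T) (iso? S T)

rootedTreeDecSetoid : DecSetoid _ _
rootedTreeDecSetoid = record
  { isDecEquivalence = record
    { isEquivalence = Setoid.isEquivalence rootedTreeSetoid ; _≟_ = _≅?_ } }

-- Sizes

mutual
  size : RootedTree → ℕ
  size (node ts) = suc (sizes ts)

  sizes : List RootedTree → ℕ
  sizes []       = 0
  sizes (t ∷ ts) = size t + sizes ts

mutual
  vertex↔Fin : ∀ T → Vertex T ↔ Fin (size T)
  vertex↔Fin (node ts) = ↔-trans vertex↔
    (↔-trans (↔-sym 1↔⊤ ⊎-↔ vertices↔Fin ts) (↔-sym +↔⊎))

  vertices↔Fin : ∀ ts → Σ (Fin (length ts)) (Vertex ∘ lookup ts) ↔ Fin (sizes ts)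
  vertices↔Fin []       = mk↔ₛ′ (λ ()) (λ ()) (λ ()) (λ ())
  vertices↔Fin (t ∷ ts) = ↔-trans
    (mk↔ₛ′ (λ { (zero , v) → inj₁ v ; (suc i , v) → inj₂ (i , v) })
           (λ { (inj₁ v) → zero , v ; (inj₂ (i , v)) → suc i , v })
           (λ { (inj₁ _) → refl ; (inj₂ _) → refl })
           (λ { (zero , _) → refl ; (suc _ , _) → refl }))
    (↔-trans (vertex↔Fin t ⊎-↔ vertices↔Fin ts) (↔-sym +↔⊎))

hasVertices⇒size : HasVertices T n → size T ≡ n
hasVertices⇒size {T} = cardinality-unique (≡.setoid (Vertex T)) (vertex↔Fin T)

size⇒hasVertices : size T ≡ n → HasVertices T n
size⇒hasVertices refl = vertex↔Fin _

≅⇒size : S ≅ T → size S ≡ size T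
≅⇒size {T = T} f = hasVertices⇒size (↔-trans (_≅_.vertices f) (vertex↔Fin T))

∈⇒size≤sizes : ∀ {t} → t ∈ ts → size t ≤ sizes ts
∈⇒size≤sizes (here refl)              = m≤m+n _ _
∈⇒size≤sizes {ts = t ∷ _} (there t∈ts) =
  ≤-trans (∈⇒size≤sizes t∈ts) (m≤n+m _ (size t))

∈⇒size< : ∀ {t} → t ∈ ts → size t < size (node ts)
∈⇒size< = s≤s ∘ ∈⇒size≤sizes

sizes-map : (f : RootedTree → RootedTree) → (∀ {t} → t ∈ ts → size (f t) ≡ size t) →
            sizes (map f ts) ≡ sizes ts
sizes-map {[]}     f eq = refl
sizes-map {t ∷ ts} f eq = cong₂ _+_ (eq (here refl)) (sizes-map f (eq ∘ there))

-- Maximal limbs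

≅⇒limb : T ≅ L → HasMaximalLimb T L
≅⇒limb {node ts} e = root , e

children⇒limb : Any (λ t → HasMaximalLimb t L) ts → HasMaximalLimb (node ts) L
children⇒limb a with lookup-index a
... | v , e = child (Any.index a) v , e

limb-view : HasMaximalLimb (node ts) L →
            node ts ≅ L ⊎ Any (λ t → HasMaximalLimb t L) ts
limb-view (root      , e) = inj₁ e
limb-view (child i v , e) = inj₂ (lose (∈-lookup i) (v , e))

mutual
  hasMaximalLimb? : ∀ L T → Dec (HasMaximalLimb T L)
  hasMaximalLimb? L (node ts) = map′ [ ≅⇒limb , children⇒limb ]′ limb-view
    (node ts ≅? L ⊎-dec anyHasMaximalLimb? L ts)

  anyHasMaximalLimb? : ∀ L ts → Dec (Any (λ t → HasMaximalLimb t L) ts)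
  anyHasMaximalLimb? L []       = no λ ()
  anyHasMaximalLimb? L (t ∷ ts) = map′ Any.fromSum Any.toSum
    (hasMaximalLimb? L t ⊎-dec anyHasMaximalLimb? L ts)

-- For trees of equal size only the first case survives, so neither of two distinct trees of the
-- same size is a limb of the other.
limb-≅-or-smaller : ∀ T → HasMaximalLimb T L → T ≅ L ⊎ size L < size T
limb-≅-or-smaller {L} = tree-induction _ λ ts ih l → case limb-view l of λ where
  (inj₁ e) → inj₁ e
  (inj₂ a) → let t , t∈ts , l′ = find a in
    inj₂ ([ (λ e → subst (_< size (node ts)) (≅⇒size e) (∈⇒size< t∈ts))
          , (λ lt → ≤-trans lt (<⇒≤ (∈⇒size< t∈ts))) ]′ (ih t∈ts l′))

-- Finite enumeration

-- A generous superset of the forests with at most `n` vertices: the first tree's children and the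
-- remaining trees each receive the full budget. The excess and the repetitions are filtered out
-- later.
forests : ℕ → List (List RootedTree)
forests zero    = [ [] ]
forests (suc n) =
  [] ∷ cartesianProductWith (λ us ts → node us ∷ ts) (forests n) (forests n)

∈-forests : ∀ n ts → sizes ts ≤ n → ts ∈ forests n
∈-forests zero    []             _ = here refl
∈-forests zero    (node _ ∷ _)   ()
∈-forests (suc n) []             _ = here refl
∈-forests (suc n) (node us ∷ ts) (s≤s le) = there
  (∈-cartesianProductWith⁺ _ (∈-forests n us (m+n≤o⇒m≤o _ le))
                             (∈-forests n ts (m+n≤o⇒n≤o (sizes us) le)))

trees : ℕ → List RootedTree
trees n = map node (forests n)

∈-trees : size T ≤ n → T ∈ trees n
∈-trees {node ts} le = ∈-map⁺ node (∈-forests _ ts (<⇒≤ le))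

module _ (DS : DecSetoid a r) where
  open DecSetoid DS renaming
    (Carrier to A; setoid to DSetoid; _≟_ to _≈?_;
     refl to ≈-refl; sym to ≈-sym; trans to ≈-trans)
  open SetoidMembership DSetoid using () renaming (_∈_ to _∈ₛ_)
  open SetoidUnique DSetoid using (Unique)

  lookup-injective : ∀ {xs} → Unique xs → ∀ i j →
                     lookup xs i ≈ lookup xs j → i ≡ j
  lookup-injective (_   ∷ _)  zero    zero    _ = refl
  lookup-injective (x≉ ∷ _)   zero    (suc j) e =
    contradiction e (All.lookup x≉ (∈-lookup j))
  lookup-injective (x≉ ∷ _)   (suc i) zero    e =
    contradiction (≈-sym e) (All.lookup x≉ (∈-lookup i))
  lookup-injective (_   ∷ u)  (suc i) (suc j) e = cong suc (lookup-injective u i j e)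

  -- Filtering keeps the elements of `P`, and deduplication keeps one representative per class,
  -- whose position numbers the class. Representatives are pairwise inequivalent, so the position
  -- depends on the class alone.
  finite-subset : {P : Pred A p} → Decidable P →
                  ∀ xs → (∀ {x} → P x → x ∈ xs) →
                  ∃[ k ] HasCardinality (On.setoid DSetoid (proj₁ {B = P})) k
  finite-subset {P = P} P? xs complete = length ys , record
    { to        = λ (_ , px) → Any.index (∈ys px)
    ; from      = λ i → lookup ys i , All.lookup allP (∈-lookup i)
    ; to-cong   = λ {(_ , px)} {(_ , py)} x≈y → injective _ _
        (≈-trans (≈-sym (lookup-index (∈ys px))) (≈-trans x≈y (lookup-index (∈ys py))))
    ; from-cong = λ { refl → ≈-refl }
    ; inverse   =
        (λ {i} {(_ , px)} x≈ → injective _ _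
          (≈-trans (≈-sym (lookup-index (∈ys px))) x≈))
      , (λ { {(_ , px)} refl → ≈-sym (lookup-index (∈ys px)) })
    }
    where
    ys : List A
    ys = deduplicate _≈?_ (filter P? xs)
    allP : All P ys
    allP = deduplicate⁺ _≈?_ (all-filter P? xs)
    injective : ∀ i j → lookup ys i ≈ lookup ys j → i ≡ j
    injective = lookup-injective (DecUnique.deduplicate-! DS (filter P? xs))
    ∈ys : ∀ {x} → P x → x ∈ₛ ys
    ∈ys px = ∈-deduplicate⁺ DSetoid _≈?_ (λ z≈y x≈y → ≈-trans x≈y (≈-sym z≈y))
      (Any.map (λ { refl → ≈-refl }) (∈-filter⁺ P? (complete px) px))

-- Exchanging two limbs

module Exchange (L₁ L₂ : RootedTree) (same-size : size L₁ ≡ size L₂)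
                (distinct : ¬ L₁ ≅ L₂) where

  -- Treating the two trees symmetrically lets each fact about the exchange be proved once for both
  -- directions.
  data Partner : RootedTree → RootedTree → Set where
    first  : Partner L₁ L₂
    second : Partner L₂ L₁

  private
    variable
      X Y X′ Y′ : RootedTree

  partner-sym : Partner X Y → Partner Y X
  partner-sym first  = second
  partner-sym second = first

  partner-size : Partner X Y → size X ≡ size L₁
  partner-size first  = refl
  partner-size second = sym same-size

  partner-unique : Partner X Y → Partner X′ Y′ → X ≅ X′ → Y ≡ Y′
  partner-unique first  first  _ = refl
  partner-unique first  second e = contradiction e distinct
  partner-unique second first  e = contradiction (≅-sym e) distinct
  partner-unique second second _ = refl

  Special : RootedTree → Set
  Special T = ∃[ X ] ∃[ Y ] Partner X Y × T ≅ X

  special? : ∀ T → Dec (Special T)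
  special? T = map′
    [ (λ e → L₁ , L₂ , first , e) , (λ e → L₂ , L₁ , second , e) ]′
    (λ { (_ , _ , first , e) → inj₁ e ; (_ , _ , second , e) → inj₂ e })
    (T ≅? L₁ ⊎-dec T ≅? L₂)

  replace : Dec (Special T) → RootedTree → RootedTree
  replace (yes (_ , Y , _)) _ = Y
  replace (no _)            U = U

  mutual
    exchange : RootedTree → RootedTree
    exchange (node ts) = replace (special? (node ts)) (node (exchanges ts))

    -- Spelled out instead of using `map`, to keep the recursion visibly structural.
    exchanges : List RootedTree → List RootedTree
    exchanges []       = []
    exchanges (t ∷ ts) = exchange t ∷ exchanges ts

  exchanges≡map : ∀ ts → exchanges ts ≡ map exchange ts
  exchanges≡map []       = refl
  exchanges≡map (t ∷ ts) = cong (exchange t ∷_) (exchanges≡map ts)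

  exchange-special : Partner X Y → T ≅ X → exchange T ≡ Y
  exchange-special {T = node ts} p e with special? (node ts)
  -- The decision may return another witness than the given one; by distinctness of the two trees
  -- both name the same replacement.
  ... | yes (_ , _ , p′ , e′) = partner-unique p′ p (≅-trans (≅-sym e′) e)
  ... | no ¬special           = contradiction (_ , _ , p , e) ¬special

  exchange-other : ¬ Special (node ts) → exchange (node ts) ≡ node (map exchange ts)
  exchange-other {ts} ¬special with special? (node ts)
  ... | yes special = contradiction special ¬special
  ... | no _        = cong node (exchanges≡map ts)

  exchange-size : ∀ T → size (exchange T) ≡ size T
  exchange-size = tree-induction _ λ ts ih → case special? (node ts) of λ where
    (yes (_ , _ , p , e)) → trans (cong size (exchange-special p e))
      (trans (partner-size (partner-sym p)) (sym (trans (≅⇒size e) (partner-size p))))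
    (no ¬special) → trans (cong size (exchange-other ¬special))
      (cong suc (sizes-map exchange ih))

  -- Neither the tree nor any of its limbs is large enough to be special, so nothing gets replaced.
  exchange-small : ∀ T → size T < size L₁ → exchange T ≡ T
  exchange-small = tree-induction _ λ ts ih lt → trans
    (exchange-other λ (_ , _ , p , e) →
      <-irrefl (trans (≅⇒size e) (partner-size p)) lt)
    (cong node (map-id-local (All.tabulate λ t∈ts → ih t∈ts
      (≤-trans (∈⇒size< t∈ts) (<⇒≤ lt)))))

  -- A special image has the size of L₁, so the children of its preimage are
  -- too small to change and the preimage was special already.
  exchange-¬special : ¬ Special T → ¬ Special (exchange T)
  exchange-¬special {node ts} ¬special (X , Y , p , e) =
    ¬special (X , Y , p , subst (_≅ X) unchanged e)
    where
    size-T : size (node ts) ≡ size L₁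
    size-T = trans (sym (exchange-size (node ts))) (trans (≅⇒size e) (partner-size p))
    unchanged : exchange (node ts) ≡ node ts
    unchanged = trans (exchange-other ¬special) (cong node (map-id-local
      (All.tabulate λ {t} t∈ts → exchange-small t
        (subst (size t <_) size-T (∈⇒size< t∈ts)))))

  -- Being special is invariant under isomorphism: either both trees are replaced by the same tree,
  -- or the exchange acts on children that are already matched.
  exchange-cong : ∀ S T → S ≅ T → exchange S ≅ exchange T
  exchange-cong = tree-induction _ λ where
    ss ih (node ts) f → case special? (node ss) of λ where
      (yes (_ , _ , p , e)) → Setoid.reflexive rootedTreeSetoid (trans (exchange-special p e)
        (sym (exchange-special p (≅-trans (≅-sym f) e))))
      (no ¬special) → subst₂ _≅_
        (sym (exchange-other ¬special))
        (sym (exchange-other λ (_ , _ , p , e) → ¬special (_ , _ , p , ≅-trans f e)))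
        (map-node-cong exchange exchange (children-permutation f)
          λ i → ih (∈-lookup i) _ (children-≅ f i))

  -- A special tree goes to the partner and back to the original representative. Any other tree has
  -- a non-special image, so the second exchange also acts on the children.
  exchange-involutive : ∀ T → exchange (exchange T) ≅ T
  exchange-involutive = tree-induction _ λ ts ih → case special? (node ts) of λ where
    (yes (X , Y , p , e)) → subst (_≅ node ts)
      (sym (exchange-special (partner-sym p)
        (Setoid.reflexive rootedTreeSetoid (exchange-special p e))))
      (≅-sym e)
    (no ¬special) → let eq = exchange-other ¬special in subst₂ _≅_
      (sym (trans (cong exchange eq)
        (trans (exchange-other (subst (¬_ ∘ Special) eq (exchange-¬special ¬special)))
          (cong node (sym (map-∘ ts))))))
      (cong node (map-id ts))
      (map-node-cong′ (exchange ∘ exchange) id ih)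

  -- The image of a special tree is as large as `Y`, so a limb `Y` must be all of it and the tree
  -- was `X`. Otherwise the image is not special, so the limb lies in the image of a child, where
  -- induction applies.
  exchange-limb⁻ : Partner X Y → ∀ T →
                   HasMaximalLimb (exchange T) Y → HasMaximalLimb T X
  exchange-limb⁻ {X} {Y} p = tree-induction _ λ ts ih l → case special? (node ts) of λ where
    (yes (X′ , Y′ , p′ , e)) →
      case limb-≅-or-smaller Y′
             (subst (λ U → HasMaximalLimb U Y) (exchange-special p′ e) l) of λ where
        (inj₁ Y′≅Y) → ≅⇒limb (subst (node ts ≅_)
          (partner-unique (partner-sym p′) (partner-sym p) Y′≅Y) e)
        (inj₂ lt) → contradiction lt (<-irrefl
          (trans (partner-size (partner-sym p)) (sym (partner-size (partner-sym p′)))))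
    (no ¬special) → let eq = exchange-other ¬special in
      case limb-view (subst (λ U → HasMaximalLimb U Y) eq l) of λ where
        (inj₁ e) → contradiction
          (Y , X , partner-sym p , subst (_≅ Y) (sym eq) e)
          (exchange-¬special ¬special)
        (inj₂ a) → let t , t∈ts , l′ = find (map⁻ a) in
          children⇒limb (lose t∈ts (ih t∈ts l′))

  exchange-without : Partner X Y → Setoid.Carrier (TreesWithout X n) →
                     Setoid.Carrier (TreesWithout Y n)
  exchange-without p (T , vertices , ¬limb) =
    exchange T ,
    size⇒hasVertices (trans (exchange-size T) (hasVertices⇒size vertices)) ,
    ¬limb ∘ exchange-limb⁻ p T

  treesWithout↔ : Inverse (TreesWithout L₂ n) (TreesWithout L₁ n)
  treesWithout↔ = record
    { to        = exchange-without second
    ; from      = exchange-without first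
    ; to-cong   = exchange-cong _ _
    ; from-cong = exchange-cong _ _
    ; inverse   =
        (λ {(T , _)} e → ≅-trans (exchange-cong _ _ e) (exchange-involutive T))
      , (λ {(T , _)} e → ≅-trans (exchange-cong _ _ e) (exchange-involutive T))
    }

-- Counting the trees without a given limb

treesWithout-finite : ∀ L n → ∃[ k ] HasCardinality (TreesWithout L n) k
treesWithout-finite L n = finite-subset rootedTreeDecSetoid
  (λ T → map′ size⇒hasVertices hasVertices⇒size (size T ≟ n)
         ×-dec ¬? (hasMaximalLimb? L T))
  (trees n)
  (λ (vertices , _) → ∈-trees (≤-reflexive (hasVertices⇒size vertices)))

theorem5p1 : ∀ (ℓ : ℕ) (L₁ L₂ : RootedTree) →
    HasVertices L₁ ℓ → HasVertices L₂ ℓ → ¬ (L₁ ≅ L₂) →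
    ∀ (n : ℕ) →
    ∃[ ℓ₁ₙ ] ∃[ ℓ₂ₙ ]
    HasCardinality (TreesWithout L₁ n) ℓ₁ₙ ×
    HasCardinality (TreesWithout L₂ n) ℓ₂ₙ ×
    ℓ₁ₙ ≡ ℓ₂ₙ
theorem5p1 ℓ L₁ L₂ v₁ v₂ distinct n
  with k , card ← treesWithout-finite L₁ n =
  -- The exchange turns a numbering of the trees without `L₁` into one of the trees without `L₂`, so
  -- one `k` serves for both.
  k , k , card , Composition.inverse treesWithout↔ card , refl
  where
  open Exchange L₁ L₂ (trans (hasVertices⇒size v₁) (sym (hasVertices⇒size v₂))) distinct
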